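{- Let $G=(U,V,E)$ be a finite bipartite graph with $|U|\le|V|$, and suppose that for each vertex $i\in U\cup V$ a non-negative integer $ub_i$ is given which is an upper bound involving $i$ (i.e. every balanced biclique of $G$ containing $i$ has half-size at most $ub_i$). Let $\ell=\max_{i\in U}ub_i$ and $S^{\ell-1}=\{i\in U: ub_i\le \ell-1\}$. Let $u\in S^{\ell-1}$, and let $T^{\ell-1}_u$ be any (inclusion-wise) maximal subset of $S^{\ell-1}$ containing $u$ such that $N(i)\cap N(j)=\emptyset$ for all distinct $i,j\in T^{\ell-1}_u$. Then the inequality $$\sum_{i\in T^{\ell-1}_u}(\ell-ub_i+1)\,x_i+\sum_{i\in U\setminus T^{\ell-1}_u}x_i\le \ell$$ is valid for the 0-1 formulation of the Maximum Balanced Biclique Problem on $G$; that is, it is satisfied by every $x\in\{0,1\}^{U\cup V}$ such that $x_i+x_j\le 1$ for all $\{i,j\}\in\bar E$ and $\sum_{i\in U}x_i=\sum_{j\in V}x_j$.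
   Context: A bipartite graph $G=(U,V,E)$ has two disjoint finite vertex sets $U,V$ and an edge set $E\subseteq U\times V$ (edges written as unordered pairs $\{u,v\}$ with $u\in U$, $v\in V$). $\bar E$ is the edge set of the bipartite complement of $G$, i.e. the set of pairs $\{i,j\}$ with $i\in U$, $j\in V$ and $\{i,j\}\notin E$. For a vertex $v$, $N(v)=\{u:\{v,u\}\in E\}$ is its set of neighbours. A biclique is a pair $(A,B)$ with $A\subseteq U$, $B\subseteq V$ such that $\{u,v\}\in E$ for all $u\in A$, $v\in B$. It is balanced if $|A|=|B|$, and its half-size is then $|A|$. The Maximum Balanced Biclique Problem asks for a balanced biclique of maximum half-size; its 0-1 formulation maximizes $\sum_{i\in U}x_i$ over the vectors $x\in\{0,1\}^{U\cup V}$ satisfying the two constraints listed in the claim. -}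

module Defs where

open import Data.Bool.Base using (if_then_else_)
open import Data.Empty using (⊥)
open import Data.Fin.Base using (Fin)
open import Data.Fin.Subset using (Subset; ∣_∣; _∈_; _⊆_)
open import Data.Fin.Subset.Properties using (_∈?_)
open import Data.Integer.Base as ℤ using (ℤ; +_; 0ℤ; 1ℤ)
open import Data.Integer.Properties using (+-0-commutativeMonoid)
open import Data.List.Base using (tabulate)
open import Data.List.Extrema.Nat using (max)
open import Data.Nat.Base as ℕ using (ℕ)
open import Data.Product.Base using (_×_)
open import Data.Sum.Base using (_⊎_; inj₁; inj₂)
open import Level using (0ℓ)
open import Relation.Binary.Core using (REL)
open import Relation.Binary.Definitions using (Decidable)
open import Relation.Binary.PropositionalEquality.Core using (_≡_; _≢_)
open import Relation.Nullary.Decidable.Core using (does)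
open import Relation.Nullary.Negation.Core using (¬_)
open import Relation.Unary using (Pred; Empty; _∩_)

open import Algebra.Properties.CommutativeMonoid.Sum +-0-commutativeMonoid
  using (sum)

-- U = Fin m and V = Fin n; the vertex set U ∪ V is their disjoint sum.
record BipartiteGraph (m n : ℕ) : Set₁ where
  field
    Edge  : REL (Fin m) (Fin n) 0ℓ
    edge? : Decidable Edge

Vertex : ℕ → ℕ → Set
Vertex m n = Fin m ⊎ Fin n

∑[_] : ∀ {k} → Subset k → (Fin k → ℤ) → ℤ
∑[ T ] f = sum (λ i → if does (i ∈? T) then f i else 0ℤ)

Maximal : ∀ {k} → Pred (Subset k) 0ℓ → Pred (Subset k) 0ℓ
Maximal P T = P T × (∀ T′ → P T′ → T ⊆ T′ → T′ ⊆ T)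

-- The default 0 is only attained by an empty U or by all bounds being 0.
maxU : ∀ {m n} → (Vertex m n → ℕ) → ℕ
maxU ub = max 0 (tabulate (λ i → ub (inj₁ i)))

-- The threshold is an integer so that, for ℓ = 0, the set S^(ℓ-1) is empty;
-- truncated subtraction would give {i : ub i ≤ 0} instead.
S[_] : ∀ {m n} → ℤ → (Vertex m n → ℕ) → Pred (Fin m) 0ℓ
S[ k ] ub i = + ub (inj₁ i) ℤ.≤ k

module _ {m n : ℕ} (G : BipartiteGraph m n) where
  open BipartiteGraph G

  Adjacent : Vertex m n → Vertex m n → Set
  Adjacent (inj₁ u) (inj₂ v) = Edge u v
  Adjacent (inj₂ v) (inj₁ u) = Edge u v
  Adjacent (inj₁ _) (inj₁ _) = ⊥
  Adjacent (inj₂ _) (inj₂ _) = ⊥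

  N : Vertex m n → Pred (Vertex m n) 0ℓ
  N v w = Adjacent v w

  ComplementEdge : REL (Fin m) (Fin n) 0ℓ
  ComplementEdge i j = ¬ Edge i j

  IsBiclique : Subset m → Subset n → Set
  IsBiclique A B = ∀ {u v} → u ∈ A → v ∈ B → Edge u v

  record BalancedBiclique : Set where
    field
      A        : Subset m
      B        : Subset n
      biclique : IsBiclique A B
      balanced : ∣ A ∣ ≡ ∣ B ∣

    halfSize : ℕ
    halfSize = ∣ A ∣

    Contains : Pred (Vertex m n) 0ℓ
    Contains (inj₁ u) = u ∈ A
    Contains (inj₂ v) = v ∈ B

  open BalancedBiclique using (halfSize; Contains)

  IsUpperBound : (Vertex m n → ℕ) → Set
  IsUpperBound ub =
    ∀ i (K : BalancedBiclique) → Contains K i → halfSize K ℕ.≤ ub i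

  record IsDisjointFamily (S : Pred (Fin m) 0ℓ) (u : Fin m) (T : Subset m)
         : Set where
    field
      within   : ∀ {i} → i ∈ T → S i
      contains : u ∈ T
      disjoint : ∀ {i j} → i ∈ T → j ∈ T → i ≢ j →
                 Empty (N (inj₁ i) ∩ N (inj₁ j))

  record Feasible (x : Vertex m n → ℤ) : Set where
    field
      binary   : ∀ i → x i ≡ 0ℤ ⊎ x i ≡ 1ℤ
      conflict : ∀ {i j} → ComplementEdge i j →
                 x (inj₁ i) ℤ.+ x (inj₂ j) ℤ.≤ 1ℤ
      balance  : sum (λ i → x (inj₁ i)) ≡ sum (λ j → x (inj₂ j))

{-# OPTIONS --safe #-}

-- A feasible x is the indicator vector of a balanced biclique K, and the left-hand
-- side equals halfSize K plus the sum of (ℓ − ub i) x_i over T.  The neighbourhoods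
-- of T are pairwise disjoint, so a nonempty K contains at most one vertex i of T:
-- then the bound is halfSize K ≤ ub i, and without such a vertex it is
-- halfSize K ≤ ℓ.
module Submission where

open import Defs
open import Data.Nat.Base as ℕ using (ℕ)
open import Data.Fin.Base using (Fin)
open import Data.Fin.Subset using (Subset; ∁)
open import Data.Integer.Base using (ℤ; +_; 1ℤ; _+_; _-_; _*_; _≤_)
open import Data.Sum.Base using (inj₁)

open import Data.Bool.Base using (if_then_else_)
open import Data.Fin.Base using (zero; suc; punchIn)
open import Data.Fin.Properties using (any?; punchInᵢ≢i) renaming (_≟_ to _≟ᶠ_)
open import Data.Fin.Subset using (∣_∣; _∈_; Nonempty)
open import Data.Fin.Subset.Properties
  using (_∈?_; nonempty?; Empty-unique; ∣⊥∣≡0; x∈p⇒∣p-x∣<∣p∣; x∈p⇒x∉∁p; x∉p⇒x∈∁p)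
open import Data.Integer.Base using (0ℤ; +≤+)
open import Data.Integer.Properties as ℤ using (+-0-commutativeMonoid)
open import Data.Integer.Tactic.RingSolver using (solve-∀)
open import Data.List.Base as List using ()
open import Data.List.Extrema.Nat using (xs≤max)
open import Data.List.Relation.Unary.All.Properties using (tabulate⁻)
open import Data.Nat.Properties as ℕ using ()
open import Data.Product.Base using (_,_)
open import Data.Sum.Base using (_⊎_; inj₂)
open import Data.Vec.Base as Vec using ()
open import Data.Vec.Functional using (removeAt)
open import Data.Vec.Properties using (lookup∘tabulate; lookup⇒[]=; []=⇒lookup)
open import Function.Base using (_∘_)
open import Relation.Binary.PropositionalEquality
  using (_≡_; _≢_; refl; sym; trans; cong; subst; module ≡-Reasoning)
open import Relation.Nullary
  using (¬_; yes; no; does; contradiction; _×-dec_)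
open import Relation.Nullary.Decidable using (dec-true; dec-false; decidable-stable)

open import Algebra.Properties.CommutativeMonoid.Sum +-0-commutativeMonoid
  using (sum; sum-remove; sum-cong-≗; sum-replicate-zero; ∑-distrib-+)

sum-zero : ∀ {k} (f : Fin k → ℤ) → (∀ i → f i ≡ 0ℤ) → sum f ≡ 0ℤ
sum-zero {k} f f≡0 = trans (sum-cong-≗ f≡0) (sum-replicate-zero k)

-- Splitting off the entry at `i` leaves the indices `punchIn i j`, none of which equals `i`.
sum-single : ∀ {k} (f : Fin k → ℤ) i → (∀ j → j ≢ i → f j ≡ 0ℤ) → sum f ≡ f i
sum-single {ℕ.suc _} f i f≡0 = begin
  sum f                      ≡⟨ sum-remove {i = i} f ⟩
  f i + sum (removeAt f i)   ≡⟨ cong (_+_ (f i)) (sum-zero (removeAt f i) λ j →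
                                  f≡0 (punchIn i j) (punchInᵢ≢i i j)) ⟩
  f i + 0ℤ                   ≡⟨ ℤ.+-identityʳ (f i) ⟩
  f i                        ∎
  where open ≡-Reasoning

module _ {k} (T : Subset k) (f : Fin k → ℤ) where

  -- Names the summand of `∑[ T ] f`, which is `sum (restrict T f)` by definition, so that facts
  -- about `sum` apply to it.
  restrict : Fin k → ℤ
  restrict i = if does (i ∈? T) then f i else 0ℤ

  restrict-∈ : ∀ {i} → i ∈ T → restrict i ≡ f i
  restrict-∈ {i} i∈T = cong (λ b → if b then f i else 0ℤ) (dec-true (i ∈? T) i∈T)

  restrict-zero : ∀ i → (i ∈ T → f i ≡ 0ℤ) → restrict i ≡ 0ℤ
  restrict-zero i f≡0 with i ∈? T
  ... | yes i∈T = f≡0 i∈T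
  ... | no  _   = refl

-- Holds index by index: on `T` the 1 in the coefficient supplies the copy of `x i`, and off `T` the
-- second sum does.
∑-weighted-split : ∀ {k} (T : Subset k) (w x : Fin k → ℤ) →
  ∑[ T ] (λ i → (w i + 1ℤ) * x i) + ∑[ ∁ T ] x ≡ sum x + ∑[ T ] (λ i → w i * x i)
∑-weighted-split T w x = begin
  sum w+1-on-T + sum off-T              ≡⟨ ∑-distrib-+ w+1-on-T off-T ⟨
  sum (λ i → w+1-on-T i + off-T i)      ≡⟨ sum-cong-≗ pointwise ⟩
  sum (λ i → x i + w-on-T i)            ≡⟨ ∑-distrib-+ x w-on-T ⟩
  sum x + sum w-on-T                    ∎
  where
  open ≡-Reasoning

  w+1-on-T = restrict T (λ i → (w i + 1ℤ) * x i)
  w-on-T   = restrict T (λ i → w i * x i)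
  off-T    = restrict (∁ T) x

  distrib : ∀ a b → (a + 1ℤ) * b + 0ℤ ≡ b + a * b
  distrib = solve-∀

  pointwise : ∀ i → w+1-on-T i + off-T i ≡ x i + w-on-T i
  -- This evaluates both restrictions to `T`; membership in `∁ T` is a separate decision and is
  -- treated by hand in each case.
  pointwise i with i ∈? T
  ... | yes i∈T = trans
    (cong (_+_ ((w i + 1ℤ) * x i))
          (restrict-zero (∁ T) x i (λ i∈∁T → contradiction i∈∁T (x∈p⇒x∉∁p i∈T))))
    (distrib (w i) (x i))
  ... | no  i∉T = trans
    (cong (_+_ 0ℤ) (restrict-∈ (∁ T) x (x∉p⇒x∈∁p i∉T)))
    (ℤ.+-comm 0ℤ (x i))

support : ∀ {k} → (Fin k → ℤ) → Subset k
support x = Vec.tabulate (λ i → does (x i ℤ.≟ 1ℤ))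

∈-support⁺ : ∀ {k} (x : Fin k → ℤ) {i} → x i ≡ 1ℤ → i ∈ support x
∈-support⁺ x {i} xi≡1 =
  lookup⇒[]= i _ (trans (lookup∘tabulate _ i) (dec-true (x i ℤ.≟ 1ℤ) xi≡1))

∈-support⁻ : ∀ {k} (x : Fin k → ℤ) {i} → i ∈ support x → x i ≡ 1ℤ
∈-support⁻ x {i} i∈ = decidable-stable (x i ℤ.≟ 1ℤ) λ xi≢1 →
  -- If `x i` were not 1, the entry of `support x` at `i` would be both `false` and `true`.
  contradiction
    (trans (sym (dec-false (x i ℤ.≟ 1ℤ) xi≢1))
           (trans (sym (lookup∘tabulate _ i)) ([]=⇒lookup i∈)))
    λ ()

sum-binary : ∀ {k} (x : Fin k → ℤ) → (∀ i → x i ≡ 0ℤ ⊎ x i ≡ 1ℤ) →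
             sum x ≡ + ∣ support x ∣
sum-binary {ℕ.zero}  x bin = refl
sum-binary {ℕ.suc k} x bin
  -- Abstracting `x zero` along with its binarity lets `refl` turn it into 0 or 1, after which the
  -- first entry of `support x` computes.
  with x zero | bin zero | sum-binary (x ∘ suc) (bin ∘ suc)
... | _ | inj₁ refl | ih = trans (ℤ.+-identityˡ _) ih
... | _ | inj₂ refl | ih = cong (_+_ 1ℤ) ih

∣p∣>0⇒Nonempty : ∀ {k} {p : Subset k} → 0 ℕ.< ∣ p ∣ → Nonempty p
∣p∣>0⇒Nonempty {k} {p} 0<∣p∣ = decidable-stable (nonempty? p) λ empty →
  ℕ.<⇒≢ 0<∣p∣ (sym (trans (cong ∣_∣ (Empty-unique empty)) (∣⊥∣≡0 k)))

x∈p⇒∣p∣>0 : ∀ {k} {p : Subset k} {i} → i ∈ p → 0 ℕ.< ∣ p ∣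
x∈p⇒∣p∣>0 i∈p = ℕ.≤-<-trans ℕ.z≤n (x∈p⇒∣p-x∣<∣p∣ i∈p)

ub≤maxU : ∀ {m n} (ub : Vertex m n → ℕ) i → ub (inj₁ i) ℕ.≤ maxU ub
ub≤maxU ub = tabulate⁻ (xs≤max 0 (List.tabulate (ub ∘ inj₁)))

module _ {m n : ℕ} (G : BipartiteGraph m n) where
  open BipartiteGraph G
  open BalancedBiclique

  -- Half-size 0 is trivial; otherwise any `i` in `A K` gives `halfSize K` ≤ `ub i` ≤ `maxU ub`.
  halfSize≤maxU : ∀ {ub} → IsUpperBound G ub → (K : BalancedBiclique G) →
                  halfSize K ℕ.≤ maxU ub
  halfSize≤maxU {ub} isUB K with 0 ℕ.<? halfSize K
  ... | no  k≯0 = ℕ.≤-trans (ℕ.≮⇒≥ k≯0) ℕ.z≤n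
  ... | yes k>0 with ∣p∣>0⇒Nonempty k>0
  ...   | i , i∈A = ℕ.≤-trans (isUB (inj₁ i) K i∈A) (ub≤maxU ub i)

  -- Since `A K` contains `i`, balance makes `B K` nonempty, and any vertex of `B K` is a common
  -- neighbour of `i` and `j`; distinct members of the family have none.
  ∈-family-unique : ∀ {S u T} → IsDisjointFamily G S u T → (K : BalancedBiclique G) →
                    ∀ {i j} → i ∈ T → j ∈ T → i ∈ A K → j ∈ A K → i ≡ j
  ∈-family-unique fam K {i} {j} i∈T j∈T i∈A j∈A = decidable-stable (i ≟ᶠ j) λ i≢j →
    let v , v∈B = ∣p∣>0⇒Nonempty (subst (0 ℕ.<_) (balanced K) (x∈p⇒∣p∣>0 i∈A))
    in IsDisjointFamily.disjoint fam i∈T j∈T i≢j (inj₂ v)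
         (biclique K i∈A v∈B , biclique K j∈A v∈B)

  module _ {x : Vertex m n → ℤ} (feasible : Feasible G x) where
    open Feasible feasible

    supportBiclique : BalancedBiclique G
    supportBiclique = record
      { A        = support (x ∘ inj₁)
      ; B        = support (x ∘ inj₂)
      -- Two selected vertices without an edge would turn the conflict constraint into 1 + 1 ≤ 1.
      ; biclique = λ {u} {v} u∈A v∈B → decidable-stable (edge? u v) λ ¬e →
          contradiction (conflict ¬e)
            (2≰1 (∈-support⁻ (x ∘ inj₁) u∈A) (∈-support⁻ (x ∘ inj₂) v∈B))
      ; balanced = ℤ.+-injective (begin
          + ∣ support (x ∘ inj₁) ∣  ≡⟨ sum-binary (x ∘ inj₁) (binary ∘ inj₁) ⟨
          sum (x ∘ inj₁)            ≡⟨ balance ⟩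
          sum (x ∘ inj₂)            ≡⟨ sum-binary (x ∘ inj₂) (binary ∘ inj₂) ⟩
          + ∣ support (x ∘ inj₂) ∣  ∎)
      }
      where
      open ≡-Reasoning

      2≰1 : ∀ {a b} → a ≡ 1ℤ → b ≡ 1ℤ → ¬ (a + b ≤ 1ℤ)
      2≰1 refl refl (+≤+ (ℕ.s≤s ()))

    ∉-support : ∀ {i} → x i ≢ 1ℤ → x i ≡ 0ℤ
    ∉-support {i} xi≢1 with binary i
    ... | inj₁ xi≡0 = xi≡0
    ... | inj₂ xi≡1 = contradiction xi≡1 xi≢1

mainTheorem4 :
    ∀ {m n : ℕ} (G : BipartiteGraph m n) → m ℕ.≤ n →
    (ub : Vertex m n → ℕ) → IsUpperBound G ub →
    let ℓ : ℤ
        ℓ = + maxU ub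
        S = S[ ℓ - 1ℤ ] ub
    in
    (u : Fin m) → S u →
    (T : Subset m) → Maximal (IsDisjointFamily G S u) T →
    (x : Vertex m n → ℤ) → Feasible G x →
    ∑[ T ] (λ i → (ℓ - + ub (inj₁ i) + 1ℤ) * x (inj₁ i))
      + ∑[ ∁ T ] (λ i → x (inj₁ i))
      ≤ ℓ
mainTheorem4 {m} G _ ub isUB u _ T (fam , _) x feasible = begin
  ∑[ T ] (λ i → (w i + 1ℤ) * xᵁ i) + ∑[ ∁ T ] xᵁ  ≡⟨ ∑-weighted-split T w xᵁ ⟩
  sum xᵁ + ∑[ T ] wx                              ≡⟨ cong (_+ ∑[ T ] wx) sum≡k ⟩
  + k + ∑[ T ] wx                                 ≤⟨ bound ⟩
  ℓ                                               ∎
  where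
  open ℤ.≤-Reasoning

  ℓ = + maxU ub
  K = supportBiclique G feasible
  k = BalancedBiclique.halfSize K

  xᵁ w wx : Fin m → ℤ
  xᵁ i = x (inj₁ i)
  w i  = ℓ - + ub (inj₁ i)
  wx i = w i * xᵁ i

  sum≡k : sum xᵁ ≡ + k
  sum≡k = sum-binary xᵁ (λ i → Feasible.binary feasible (inj₁ i))

  wx≡0 : ∀ {i} → xᵁ i ≢ 1ℤ → wx i ≡ 0ℤ
  wx≡0 {i} xi≢1 =
    trans (cong (_*_ (w i)) (∉-support G feasible xi≢1)) (ℤ.*-zeroʳ (w i))

  cancel : ∀ a b → b + (a - b) * 1ℤ ≡ a
  cancel = solve-∀

  bound : + k + ∑[ T ] wx ≤ ℓ
  bound with any? (λ i → (i ∈? T) ×-dec (xᵁ i ℤ.≟ 1ℤ))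
  -- Every selected vertex lies outside `T`, so the weighted sum vanishes and the global bound on
  -- the half-size remains.
  ... | no none = begin
    + k + ∑[ T ] wx  ≡⟨ cong (_+_ (+ k)) (sum-zero _ λ i → restrict-zero T wx i λ i∈T →
                          wx≡0 λ xi≡1 → none (i , i∈T , xi≡1)) ⟩
    + k + 0ℤ         ≡⟨ ℤ.+-identityʳ (+ k) ⟩
    + k              ≤⟨ +≤+ (halfSize≤maxU G isUB K) ⟩
    ℓ                ∎
  ... | yes (i , i∈T , xi≡1) = begin
    -- A second selected `j` in `T` would have to equal `i`, so only the term at `i` survives.
    + k + ∑[ T ] wx          ≡⟨ cong (_+_ (+ k)) (sum-single _ i λ j j≢i →
                                  restrict-zero T wx j λ j∈T → wx≡0 λ xj≡1 →
                                  j≢i (∈-family-unique G fam K j∈T i∈T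
                                         (∈-support⁺ xᵁ xj≡1) i∈A)) ⟩
    + k + restrict T wx i    ≡⟨ cong (_+_ (+ k)) (restrict-∈ T wx i∈T) ⟩
    + k + w i * xᵁ i         ≡⟨ cong (λ z → + k + w i * z) xi≡1 ⟩
    -- Once `k` is replaced by `ub (inj₁ i)`, the weight `w i` is exactly the gap up to `ℓ`.
    + k + w i * 1ℤ           ≤⟨ ℤ.+-monoˡ-≤ (w i * 1ℤ) (+≤+ (isUB (inj₁ i) K i∈A)) ⟩
    + ub (inj₁ i) + w i * 1ℤ ≡⟨ cancel ℓ (+ ub (inj₁ i)) ⟩
    ℓ                        ∎
    where
    i∈A : i ∈ support xᵁ
    i∈A = ∈-support⁺ xᵁ xi≡1
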